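{- Let $n>1$, let $L\in\mathbb{R}^{n\times n}$ be the Laplacian matrix of a simple undirected graph $G$ with $n$ nodes, and let $\widehat{L}=PLP^T$ be the matrix obtained from the RCM (Reverse Cuthill-McKee) algorithm applied to $L$. For $i\in\{1,\dots,n\}$ let $\mathbf{e}_i\in\mathbb{R}^{n\times 1}$ be the vector with ones in its first $i$ entries and zeros elsewhere. Then $\widehat{L}$ is irreducible if and only if $\widehat{L}\,\mathbf{e}_i\neq\mathbf{0}$ for $i=1,2,\dots,n-1$.
   Context: Graphs are finite, undirected, without loops or multiple edges. For a graph with $n$ nodes numbered $1,\dots,n$ and adjacency matrix $A=(a_{ij})$, the (unnormalized) Laplacian matrix is $L=D-A$, where $D=\mathrm{diag}(d_1,\dots,d_n)$ and $d_i=\sum_{j}a_{ij}$ is the degree of node $i$. RCM ordering: build a list $u_1,u_2,\dots,u_n$ of all nodes as follows. Select a starting node (arbitrary, e.g. one of lowest degree) and let it be $u_1$. For $i=1,2,\dots$ in turn, append to the end of the list the neighbors of $u_i$ that are not yet in the list, in increasing order of degree (ties broken arbitrarily). If all listed nodes have been processed in this way but some nodes are not yet listed, select a new starting node among the unlisted ones, append it to the list, and continue. Finally reverse the order: node $u_j$ receives the new number $n+1-j$. If $P$ is the corresponding permutation matrix ($p_{ij}=1$ iff the node with new number $i$ has original number $j$), the Laplacian of the graph ordered by RCM is $\widehat{L}=PLP^T$. A matrix $M\in\mathbb{R}^{n\times n}$ with $n\ge 2$ is reducible if there are a permutation matrix $Q$ and an integer $1\le r\le n-1$ such that $Q^TMQ=\begin{bmatrix}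 B & C\\ 0 & E\end{bmatrix}$ with $B\in\mathbb{R}^{r\times r}$ and $0$ the $(n-r)\times r$ zero block; a $1\times 1$ matrix is reducible if it is $0$. A matrix is irreducible if it is not reducible. -}

module Defs where

open import Algebra.Bundles using (CommutativeRing)
open import Data.Bool.Base using (Bool; true; false; if_then_else_)
open import Data.Fin.Base using (Fin; zero; toℕ)
open import Data.Fin.Permutation using (Permutation′; _⟨$⟩ʳ_)
open import Data.Fin.Properties using (_≟_)
open import Data.List.Base using (List; []; _∷_; [_]; _++_; _∷ʳ_; reverse; tabulate)
open import Data.List.Membership.Propositional using (_∈_; _∉_)
open import Data.List.Relation.Unary.Linked using (Linked)
open import Data.List.Relation.Unary.Unique.Propositional using (Unique)
open import Data.Nat.Base using (ℕ; suc; _≤_; _<_; _∸_)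
import Data.Nat.Properties as ℕ
open import Data.Nat.Properties using (_<?_)
open import Data.Product.Base using (∃; _×_)
open import Data.Vec.Functional using (Vector)
open import Function.Base using (_on_)
open import Function.Bundles using (_⇔_)
import Level
open import Relation.Binary.PropositionalEquality.Core using (_≡_)
open import Relation.Nullary using (¬_; does)

import Algebra.Definitions.RawMonoid as RawMonoid
import Algebra.Properties.Semiring.Sum as Sum
import Data.Vec.Functional.Relation.Binary.Equality.Setoid as VectorEquality

record Graph (n : ℕ) : Set where
  field
    adjacent    : Fin n → Fin n → Bool
    symmetric   : ∀ i j → adjacent i j ≡ adjacent j i
    irreflexive : ∀ i → adjacent i i ≡ false

module _ {n : ℕ} (G : Graph n) where
  open Graph G

  -- The degree as a natural number, used only to compare nodes.
  degree : Fin n → ℕ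
  degree i = Sum.sum ℕ.+-*-semiring (λ j → if adjacent i j then 1 else 0)

  -- CuthillMcKee us qs: some run of the (nondeterministic) numbering procedure
  -- reaches the list us ++ qs, in which exactly the nodes of us have already
  -- been processed.
  data CuthillMcKee : List (Fin n) → List (Fin n) → Set where
    begin   : CuthillMcKee [] []
    -- Select a starting node; possible only once every listed node is processed.
    start   : ∀ {us} → CuthillMcKee us [] →
              ∀ s → s ∉ us → CuthillMcKee us [ s ]
    -- Process u: vs enumerates, by increasing degree and with ties in any
    -- order, the neighbours of u that are not yet listed.
    process : ∀ {us u qs} → CuthillMcKee us (u ∷ qs) →
              ∀ vs → Unique vs →
              (∀ v → v ∈ vs ⇔ (adjacent u v ≡ true × v ∉ us ++ u ∷ qs)) →
              Linked (_≤_ on degree) vs →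
              CuthillMcKee (us ∷ʳ u) (qs ++ vs)

  -- π sends each new number to the original number of the node receiving it.
  -- Several π can be RCM orderings of the same graph.
  IsRCM : Permutation′ n → Set
  IsRCM π = ∃ λ us → CuthillMcKee us [] × (∀ v → v ∈ us) ×
                     tabulate (π ⟨$⟩ʳ_) ≡ reverse us

-- The library has no real numbers. Matrices have entries in a commutative ring,
-- which the hypothesis CharacteristicZero restricts to those in which, as in ℝ,
-- no positive integer vanishes.
module Matrices {c ℓ} (R : CommutativeRing c ℓ) where
  open CommutativeRing R hiding (zero)
  open RawMonoid +-rawMonoid using () renaming (_×_ to _·_)
  open Sum semiring using (sum)
  open VectorEquality setoid public using (_≋_)

  CharacteristicZero : Set ℓ
  CharacteristicZero = ∀ k → ¬ (suc k · 1# ≈ 0#)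

  Matrix : ℕ → ℕ → Set c
  Matrix m n = Fin m → Fin n → Carrier

  infixl 7 _⊗_ _⊗ᵥ_
  infixl 8 _ᵀ

  _⊗_ : ∀ {m n p} → Matrix m n → Matrix n p → Matrix m p
  (M ⊗ N) i k = sum λ j → M i j * N j k

  _⊗ᵥ_ : ∀ {m n} → Matrix m n → Vector Carrier n → Vector Carrier m
  (M ⊗ᵥ x) i = sum λ j → M i j * x j

  _ᵀ : ∀ {m n} → Matrix m n → Matrix n m
  (M ᵀ) i j = M j i

  0ᵥ : ∀ {n} → Vector Carrier n
  0ᵥ _ = 0#

  diag : ∀ {n} → Vector Carrier n → Matrix n n
  diag d i j = if does (i ≟ j) then d i else 0#

  permutationMatrix : ∀ {n} → Permutation′ n → Matrix n n
  permutationMatrix π i j = if does (π ⟨$⟩ʳ i ≟ j) then 1# else 0#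

  -- Indices are 0-based, so the lower left (n - r) × r block consists of the
  -- entries (k , l) with r ≤ k and l < r.
  data Reducible : ∀ {n} → Matrix n n → Set (c Level.⊔ ℓ) where
    zero₁ : {M : Matrix 1 1} → M zero zero ≈ 0# → Reducible M
    block : ∀ {n} {M : Matrix n n} → 2 ≤ n →
            (σ : Permutation′ n) (r : ℕ) → 1 ≤ r → r ≤ n ∸ 1 →
            (let Q = permutationMatrix σ in
             ∀ k l → r ≤ toℕ k → toℕ l < r → (Q ᵀ ⊗ M ⊗ Q) k l ≈ 0#) →
            Reducible M

  Irreducible : ∀ {n} → Matrix n n → Set (c Level.⊔ ℓ)
  Irreducible M = ¬ Reducible M

  -- The vector whose first i entries are 1 and whose other entries are 0.
  e : ∀ {n} → ℕ → Vector Carrier n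
  e i j = if does (toℕ j <? i) then 1# else 0#

  adjacencyMatrix : ∀ {n} → Graph n → Matrix n n
  adjacencyMatrix G i j = if Graph.adjacent G i j then 1# else 0#

  laplacian : ∀ {n} → Graph n → Matrix n n
  laplacian G i j = diag (λ k → sum (A k)) i j - A i j
    where A = adjacencyMatrix G

{-# OPTIONS --safe #-}

-- L̂ eᵢ vanishes exactly when no edge joins the first i nodes of the new order
-- to the remaining ones: each of the last n - i entries of L̂ eᵢ is minus the number of
-- neighbours among the first i nodes, and conversely every row of a Laplacian
-- sums to 0. Such an i makes L̂ block triangular already without permuting it.
-- If L̂ is reducible, its two blocks give a 2-colouring of the nodes, with both
-- colours used, whose edges join nodes of equal colour. All nodes reached from
-- one starting node share its colour, so a second one has to be selected. The
-- nodes listed before it are closed under adjacency, and after the reversal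
-- they are the last ones.
module Submission where

open import Defs hiding (begin)
open import Algebra.Bundles using (CommutativeRing)
open import Data.Bool.Base using (Bool; true; false; _∧_; if_then_else_)
open import Data.Bool.Properties using (∧-identityʳ; ∧-zeroʳ; ¬-not)
open import Data.Fin.Base using (Fin; zero; suc; toℕ; fromℕ<)
open import Data.Fin.Permutation
  using (Permutation′; _⟨$⟩ʳ_; _⟨$⟩ˡ_; inverseˡ; inverseʳ; id; flip; _∘ₚ_)
open import Data.Fin.Properties using (_≟_; toℕ-fromℕ<; punchInᵢ≢i)
open import Data.List.Base
  using (List; []; _∷_; [_]; _++_; _∷ʳ_; reverse; length; tabulate)
open import Data.List.Membership.Propositional using (_∈_)
open import Data.List.Membership.Propositional.Properties
  using (∈-++⁺ˡ; ∈-++⁺ʳ; ∈-++⁻; ∈-tabulate⁺; ∈-tabulate⁻)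
import Data.List.Membership.DecPropositional as DecMembership
open import Data.List.Properties
  using (++-assoc; ++-identityʳ; ∷-injective; reverse-++; length-++;
         length-reverse; length-tabulate)
open import Data.List.Relation.Unary.Any using (here)
open import Data.List.Relation.Unary.Any.Properties using (reverse⁺; reverse⁻)
open import Data.Nat.Base using (ℕ; zero; suc; _+_; _<_; _≤_; _∸_; z≤n; s≤s)
open import Data.Nat.Properties
  using (_<?_; ≤-trans; <-irrefl; m≤m+n; m<m+n; ≮⇒≥; <⇒≱; ≤⇒≯; ∸-monoˡ-≤)
open import Data.Product.Base using (∃; ∃₂; _×_; _,_; proj₁; proj₂)
open import Data.Sum.Base using (_⊎_; inj₁; inj₂)
open import Data.Vec.Functional using (removeAt)
open import Function.Base using (_∘_)
open import Function.Bundles using (_⇔_; mk⇔; Equivalence; Injection)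
open import Function.Properties.Inverse using (↔⇒↣)
open import Relation.Binary.PropositionalEquality
  using (_≡_; _≢_; refl; sym; trans; cong; cong₂; subst)
open import Relation.Nullary using (¬_; Dec; does; yes; no; contradiction)
open import Relation.Nullary.Decidable using (dec-true; dec-false)

import Algebra.Definitions.RawMonoid as RawMonoid
import Algebra.Properties.Ring as RingProperties
import Algebra.Properties.Semiring.Sum as Sum
import Relation.Binary.Reasoning.Setoid as SetoidReasoning

-- Index bounds and suffixes of tabulated lists

i≤n∸1⇒i<n : ∀ {i n} → 1 ≤ i → i ≤ n ∸ 1 → i < n
i≤n∸1⇒i<n {n = zero}  (s≤s _) ()
i≤n∸1⇒i<n {n = suc n} _       i≤n = s≤s i≤n

⟨$⟩ʳ-injective : ∀ {n} (π : Permutation′ n) {i j} → π ⟨$⟩ʳ i ≡ π ⟨$⟩ʳ j → i ≡ j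
⟨$⟩ʳ-injective π = Injection.injective (↔⇒↣ π)

module _ {a} {A : Set a} where

  -- Meant for `xs` a reversed suffix and `ys` a reversed prefix of the numbering: this lemma and
  -- its converse translate between nodes listed early and late positions in the reversed order.
  tabulate-suffix⁺ : ∀ {n} (f : Fin n → A) xs {ys} → tabulate f ≡ xs ++ ys →
                     ∀ i → length xs ≤ toℕ i → f i ∈ ys
  tabulate-suffix⁺ f []       eq i       _ = subst (f i ∈_) eq (∈-tabulate⁺ i)
  tabulate-suffix⁺ f (x ∷ xs) eq (suc i) (s≤s le) =
    tabulate-suffix⁺ (f ∘ suc) xs (proj₂ (∷-injective eq)) i le

  tabulate-suffix⁻ : ∀ {n} (f : Fin n → A) xs {ys} → tabulate f ≡ xs ++ ys →
                     ∀ {y} → y ∈ ys → ∃ λ i → length xs ≤ toℕ i × y ≡ f i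
  tabulate-suffix⁻ f [] eq y∈ys
    with i , y≡fi ← ∈-tabulate⁻ (subst (_ ∈_) (sym eq) y∈ys) = i , z≤n , y≡fi
  tabulate-suffix⁻ {suc n} f (x ∷ xs) eq y∈ys
    with i , le , y≡fi ← tabulate-suffix⁻ (f ∘ suc) xs (proj₂ (∷-injective eq)) y∈ys
    = suc i , s≤s le , y≡fi

-- Closed prefixes and colours along a Cuthill-McKee run

module _ {n : ℕ} (G : Graph n) where
  open Graph G

  Closed : List (Fin n) → Set
  Closed us = ∀ {u v} → u ∈ us → adjacent u v ≡ true → v ∈ us

  -- Both parts have to be nonempty so that the cut between them yields an index from `1` to
  -- `n ∸ 1`.
  record ClosedPrefix (ws : List (Fin n)) : Set where
    constructor closedPrefix
    field
      {prefix suffix} : List (Fin n)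
      split           : ws ≡ prefix ++ suffix
      prefix-nonempty : 1 ≤ length prefix
      suffix-nonempty : 1 ≤ length suffix
      closed          : Closed prefix

  process-++ : ∀ (us : List (Fin n)) u qs vs →
               (us ++ u ∷ qs) ++ vs ≡ (us ∷ʳ u) ++ (qs ++ vs)
  process-++ us u qs vs =
    trans (++-assoc us (u ∷ qs) vs) (sym (++-assoc us [ u ] (qs ++ vs)))

  -- Processing `u` appends exactly those of its neighbours that are still missing, and nothing ever
  -- leaves the list. Once the queue is empty this makes the processed nodes closed under adjacency.
  neighbours-listed : ∀ {us qs} → CuthillMcKee G us qs →
                      ∀ {u v} → u ∈ us → adjacent u v ≡ true → v ∈ us ++ qs
  neighbours-listed (start {us} cm s _) u∈us uv =
    ∈-++⁺ˡ (subst (_ ∈_) (++-identityʳ us) (neighbours-listed cm u∈us uv))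
  neighbours-listed (process {us} {u} {qs} cm vs _ new _) {v = v} u′∈ uv =
    subst (v ∈_) (process-++ us u qs vs) (listed (∈-++⁻ us u′∈))
    where
    open DecMembership (_≟_ {n}) using (_∈?_)
    listed : _ ∈ us ⊎ _ ∈ [ u ] → v ∈ (us ++ u ∷ qs) ++ vs
    listed (inj₁ u′∈us) = ∈-++⁺ˡ (neighbours-listed cm u′∈us uv)
    listed (inj₂ (here refl)) with v ∈? us ++ u ∷ qs
    ... | yes v∈ = ∈-++⁺ˡ v∈
    ... | no  v∉ = ∈-++⁺ʳ _ (Equivalence.from (new v) (uv , v∉))

  closed-when-processed : ∀ {us} → CuthillMcKee G us [] → Closed us
  closed-when-processed cm u∈us uv =
    subst (_ ∈_) (++-identityʳ _) (neighbours-listed cm u∈us uv)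

  module _ {a} {A : Set a} (colour : Fin n → A)
           (edge-colour : ∀ {u v} → adjacent u v ≡ true → colour u ≡ colour v) where

    Monochromatic : List (Fin n) → Set a
    Monochromatic ws = ∀ {v w} → v ∈ ws → w ∈ ws → colour v ≡ colour w

    -- Up to the second start every new node is a neighbour of a listed one and inherits its colour.
    -- From the second start on, a closed prefix exists and persists.
    closedPrefix⊎monochromatic : ∀ {us qs} → CuthillMcKee G us qs →
                                 ClosedPrefix (us ++ qs) ⊎ Monochromatic (us ++ qs)
    closedPrefix⊎monochromatic CuthillMcKee.begin = inj₂ λ ()
    closedPrefix⊎monochromatic (start {[]} _ s _) =
      inj₂ λ { (here refl) (here refl) → refl }
    -- Some node precedes `s`, so this is not the first start. The processed nodes serve as prefix
    -- and `s` alone as suffix, whatever held before.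
    closedPrefix⊎monochromatic (start {u ∷ us} cm s _) =
      inj₁ (closedPrefix refl (s≤s z≤n) (s≤s z≤n) (closed-when-processed cm))
    closedPrefix⊎monochromatic (process {us} {u} {qs} cm vs _ new _)
      with closedPrefix⊎monochromatic cm
    -- The new nodes only lengthen the suffix.
    ... | inj₁ (closedPrefix {ps} {ss} split ps≠[] ss≠[] closed) =
      inj₁ (closedPrefix
        (trans (sym (process-++ us u qs vs))
               (trans (cong (_++ vs) split) (++-assoc ps ss vs)))
        ps≠[]
        (≤-trans ss≠[] (subst (length ss ≤_) (sym (length-++ ss)) (m≤m+n _ _)))
        closed)
    -- All colours are compared with that of `u`, which is listed and adjacent to each node of `vs`.
    ... | inj₂ mono = inj₂ λ v∈ w∈ → trans (like-u v∈) (sym (like-u w∈))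
      where
      like-u : ∀ {v} → v ∈ (us ∷ʳ u) ++ (qs ++ vs) → colour v ≡ colour u
      like-u {v} v∈
        with ∈-++⁻ (us ++ u ∷ qs) (subst (v ∈_) (sym (process-++ us u qs vs)) v∈)
      ... | inj₁ v∈listed = mono v∈listed (∈-++⁺ʳ us (here refl))
      ... | inj₂ v∈vs     =
        sym (edge-colour (proj₁ (Equivalence.to (new v) v∈vs)))

  -- From a closed prefix to a cut of the reversed order

  Separates : Permutation′ n → ℕ → Set
  Separates π i = ∀ k l → i ≤ toℕ k → toℕ l < i →
                  adjacent (π ⟨$⟩ʳ k) (π ⟨$⟩ʳ l) ≡ false

  closedPrefix⇒separates :
    (π : Permutation′ n) {us : List (Fin n)} → tabulate (π ⟨$⟩ʳ_) ≡ reverse us →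
    ClosedPrefix us → ∃ λ i → 1 ≤ i × i ≤ n ∸ 1 × Separates π i
  closedPrefix⇒separates π {us} π≡us
    (closedPrefix {ps} {ss} split ps≠[] ss≠[] closed) =
    -- Reversal puts the suffix first, so the cut comes right after its nodes.
    length (reverse ss) ,
    subst (1 ≤_) (sym (length-reverse ss)) ss≠[] ,
    -- The prefix is nonempty, so the suffix is strictly shorter than `n`; subtracting 1 from both
    -- sides of that strict inequality gives the bound.
    ∸-monoˡ-≤ 1 (subst (length (reverse ss) <_) lengths
      (m<m+n _ (subst (1 ≤_) (sym (length-reverse ps)) ps≠[]))) ,
    separates
    where
    π≡ : tabulate (π ⟨$⟩ʳ_) ≡ reverse ss ++ reverse ps
    π≡ = trans π≡us (trans (cong reverse split) (reverse-++ ps ss))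

    lengths : length (reverse ss) + length (reverse ps) ≡ n
    lengths = trans (sym (length-++ (reverse ss)))
                    (trans (cong length (sym π≡)) (length-tabulate (π ⟨$⟩ʳ_)))

    separates : Separates π (length (reverse ss))
    -- An edge out of the prefix would put the node at `l` into the prefix too, hence at a position
    -- `j` beyond the cut; injectivity of `π` gives `l ≡ j`.
    separates k l i≤k l<i = ¬-not λ kl →
      let πk∈ps         = reverse⁻ (tabulate-suffix⁺ _ (reverse ss) π≡ k i≤k)
          j , i≤j , l≡j = tabulate-suffix⁻ _ (reverse ss) π≡ (reverse⁺ (closed πk∈ps kl))
      in <⇒≱ l<i (subst (λ x → _ ≤ toℕ x) (sym (⟨$⟩ʳ-injective π l≡j)) i≤j)

  rcm-separates⊎monochromatic :
    ∀ {a} {A : Set a} (colour : Fin n → A) →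
    (∀ {u v} → adjacent u v ≡ true → colour u ≡ colour v) →
    (π : Permutation′ n) → IsRCM G π →
    (∃ λ i → 1 ≤ i × i ≤ n ∸ 1 × Separates π i) ⊎ (∀ v w → colour v ≡ colour w)
  rcm-separates⊎monochromatic colour edge-colour π (us , cm , all-listed , π≡us)
    with closedPrefix⊎monochromatic colour edge-colour cm
  ... | inj₁ cp   = inj₁ (closedPrefix⇒separates π π≡us
                            (subst ClosedPrefix (++-identityʳ us) cp))
  ... | inj₂ mono = inj₂ λ v w → mono (∈-++⁺ˡ (all-listed v)) (∈-++⁺ˡ (all-listed w))

-- Sums in the ring and conjugation by permutation matrices

module MatrixProperties {c ℓ} (R : CommutativeRing c ℓ) where
  open CommutativeRing R hiding (zero)
    renaming (refl to ≈-refl; sym to ≈-sym; trans to ≈-trans; reflexive to ≈-reflexive;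
              _+_ to _⊕_)
  open RingProperties ring using (-0#≈0#; -‿+-comm; -‿involutive; -‿injective)
  open RawMonoid +-rawMonoid using () renaming (_×_ to _·_)
  open Sum semiring
    using (sum; sum-cong-≋; sum-remove; sum-replicate-zero; sum-permute; ∑-distrib-+)
  open SetoidReasoning setoid
  open Matrices R

  private variable
    n : ℕ

  ⟦_⟧ : Bool → Carrier
  ⟦ b ⟧ = if b then 1# else 0#

  sum-zero : (f : Fin n → Carrier) → (∀ j → f j ≈ 0#) → sum f ≈ 0#
  sum-zero {n} f f≈0 = ≈-trans (sum-cong-≋ f≈0) (sum-replicate-zero n)

  sum-single : (f : Fin n → Carrier) (k : Fin n) → (∀ j → k ≢ j → f j ≈ 0#) → sum f ≈ f k
  sum-single {suc n} f k f≈0 = begin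
    sum f      ≈⟨ sum-remove f ⟩
    f k ⊕ _    ≈⟨ +-congˡ (sum-zero _ λ j → f≈0 _ (punchInᵢ≢i k j ∘ sym)) ⟩
    f k ⊕ 0#   ≈⟨ +-identityʳ _ ⟩
    f k        ∎

  sum-neg : (f : Fin n → Carrier) → sum (λ j → - f j) ≈ - sum f
  sum-neg {zero}  f = ≈-sym -0#≈0#
  sum-neg {suc n} f = ≈-trans (+-congˡ (sum-neg (f ∘ suc))) (-‿+-comm _ _)

  sum-⟦⟧ : (b : Fin n → Bool) → ∃ λ k → sum (λ j → ⟦ b j ⟧) ≈ k · 1#
  sum-⟦⟧ {zero}  b = 0 , ≈-refl
  sum-⟦⟧ {suc n} b with b zero | sum-⟦⟧ (b ∘ suc)
  ... | true  | k , eq = suc k , +-congˡ eq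
  ... | false | k , eq = k , ≈-trans (+-identityˡ _) eq

  -- This replaces the positivity argument over the reals: a true entry contributes 1 and the others
  -- some `k · 1#`, so the sum would be `suc k · 1#`.
  sum-⟦⟧≈0⇒false : CharacteristicZero → (b : Fin n → Bool) →
                   sum (λ j → ⟦ b j ⟧) ≈ 0# → ∀ j → b j ≡ false
  sum-⟦⟧≈0⇒false {suc n} char₀ b sum≈0 j = ¬-not λ bj →
    let k , eq = sum-⟦⟧ (removeAt b j) in char₀ k (begin
      1# ⊕ k · 1#    ≈⟨ +-cong (≈-reflexive (cong ⟦_⟧ (sym bj))) (≈-sym eq) ⟩
      ⟦ b j ⟧ ⊕ _    ≈⟨ ≈-sym (sum-remove (λ j → ⟦ b j ⟧)) ⟩
      sum (λ j → ⟦ b j ⟧) ≈⟨ sum≈0 ⟩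
      0#             ∎)

  sum-δˡ : (f : Fin n → Carrier) (k : Fin n) → sum (λ j → ⟦ does (k ≟ j) ⟧ * f j) ≈ f k
  sum-δˡ f k = begin
    _                          ≈⟨ sum-single _ k (λ j k≢j →
      ≈-trans (*-congʳ (≈-reflexive (cong ⟦_⟧ (dec-false (k ≟ j) k≢j)))) (zeroˡ _)) ⟩
    ⟦ does (k ≟ k) ⟧ * f k     ≈⟨ *-congʳ (≈-reflexive (cong ⟦_⟧ (dec-true (k ≟ k) refl))) ⟩
    1# * f k                   ≈⟨ *-identityˡ _ ⟩
    f k                        ∎

  permutationMatrix-conj : (π : Permutation′ n) (M : Matrix n n) → ∀ k l →
    (permutationMatrix π ⊗ M ⊗ permutationMatrix π ᵀ) k l ≈ M (π ⟨$⟩ʳ k) (π ⟨$⟩ʳ l)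
  permutationMatrix-conj π M k l = begin
    (P ⊗ M ⊗ P ᵀ) k l
      -- Commuting the factors brings the entry of `P ᵀ` to the left, so that `sum-δˡ` collapses the
      -- outer sum as well as the inner one.
      ≈⟨ sum-cong-≋ (λ j → ≈-trans (*-comm _ _)
                                   (*-congˡ (sum-δˡ (λ i → M i j) (π ⟨$⟩ʳ k)))) ⟩
    sum (λ j → P l j * M (π ⟨$⟩ʳ k) j)
      ≈⟨ sum-δˡ _ (π ⟨$⟩ʳ l) ⟩
    M (π ⟨$⟩ʳ k) (π ⟨$⟩ʳ l) ∎
    where P = permutationMatrix π

  -- Since `σ` takes `i` to `j` exactly when its inverse takes `j` to `i`, transposing amounts to
  -- inverting. This reduces the conjugation in `Reducible` to `permutationMatrix-conj`.
  permutationMatrix-flip : (σ : Permutation′ n) → ∀ i j →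
    permutationMatrix σ i j ≡ permutationMatrix (flip σ) j i
  permutationMatrix-flip σ i j with σ ⟨$⟩ʳ i ≟ j
  ... | yes refl = sym (cong ⟦_⟧ (dec-true (_ ≟ i) (inverseˡ σ)))
  ... | no  σi≢j = sym (cong ⟦_⟧ (dec-false (σ ⟨$⟩ˡ j ≟ i) λ { refl → σi≢j (inverseʳ σ) }))

  permutationMatrix-conjᵀ : (σ : Permutation′ n) (M : Matrix n n) → ∀ k l →
    (permutationMatrix σ ᵀ ⊗ M ⊗ permutationMatrix σ) k l ≈ M (σ ⟨$⟩ˡ k) (σ ⟨$⟩ˡ l)
  permutationMatrix-conjᵀ σ M k l = ≈-trans
    (sum-cong-≋ λ j → *-cong
      (sum-cong-≋ λ i → *-congʳ (≈-reflexive (permutationMatrix-flip σ i k)))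
      (≈-reflexive (permutationMatrix-flip σ j l)))
    (permutationMatrix-conj (flip σ) M k l)

  -- Reducibility as a pattern of zeros

  reducible⇒zeros : {M : Matrix n n} → 1 < n → Reducible M →
    ∃₂ λ (σ : Permutation′ n) r → 1 ≤ r × r ≤ n ∸ 1 ×
      (∀ i j → r ≤ toℕ (σ ⟨$⟩ʳ i) → toℕ (σ ⟨$⟩ʳ j) < r → M i j ≈ 0#)
  reducible⇒zeros (s≤s ()) (zero₁ _)
  -- Index `i` stands at position `σ ⟨$⟩ʳ i` of the block form, so the zero block is read at the
  -- images of `i` and `j`.
  reducible⇒zeros {M = M} _ (block _ σ r 1≤r r≤n∸1 zeros) =
    σ , r , 1≤r , r≤n∸1 , λ i j r≤i j<r → begin
      M i j                                        ≡⟨ cong₂ M (inverseˡ σ) (inverseˡ σ) ⟨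
      M (σ ⟨$⟩ˡ (σ ⟨$⟩ʳ i)) (σ ⟨$⟩ˡ (σ ⟨$⟩ʳ j))    ≈⟨ permutationMatrix-conjᵀ σ M _ _ ⟨
      _                                            ≈⟨ zeros _ _ r≤i j<r ⟩
      0#                                           ∎

  zeros⇒reducible : {M : Matrix n n} → 1 < n → ∀ i → 1 ≤ i → i ≤ n ∸ 1 →
    (∀ k l → i ≤ toℕ k → toℕ l < i → M k l ≈ 0#) → Reducible M
  zeros⇒reducible {M = M} 1<n i 1≤i i≤n∸1 zeros =
    block 1<n id i 1≤i i≤n∸1 λ k l i≤k l<i →
      ≈-trans (permutationMatrix-conjᵀ id M k l) (zeros k l i≤k l<i)

  e-< : ∀ {i} {j : Fin n} → toℕ j < i → e i j ≈ 1#
  e-< {i = i} {j} j<i = ≈-reflexive (cong ⟦_⟧ (dec-true (toℕ j <? i) j<i))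

  e-≥ : ∀ {i} {j : Fin n} → i ≤ toℕ j → e i j ≈ 0#
  e-≥ {i = i} {j} i≤j = ≈-reflexive (cong ⟦_⟧ (dec-false (toℕ j <? i) (≤⇒≯ i≤j)))

  -- Entries and row sums of the Laplacian

  module _ (G : Graph n) where
    open Graph G

    laplacian-offDiagonal : ∀ {i j} → i ≢ j → laplacian G i j ≈ - ⟦ adjacent i j ⟧
    laplacian-offDiagonal {i} {j} i≢j = ≈-trans
      (+-congʳ (≈-reflexive
        (cong (λ b → if b then sum (adjacencyMatrix G i) else 0#) (dec-false (i ≟ j) i≢j))))
      (+-identityˡ _)

    laplacian-rowSum : ∀ i → sum (laplacian G i) ≈ 0#
    laplacian-rowSum i = begin
      sum (laplacian G i)                        ≈⟨ ∑-distrib-+ (diag d i) (λ j → - A i j) ⟩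
      sum (diag d i) ⊕ sum (λ j → - A i j)       ≈⟨ +-cong sum-diag (sum-neg (A i)) ⟩
      d i ⊕ - d i                                ≈⟨ -‿inverseʳ (d i) ⟩
      0#                                         ∎
      where
      A = adjacencyMatrix G
      d = λ k → sum (A k)
      entry : Bool → Carrier
      entry b = if b then d i else 0#
      sum-diag : sum (diag d i) ≈ d i
      sum-diag = ≈-trans
        (sum-single _ i λ j i≢j → ≈-reflexive (cong entry (dec-false (i ≟ j) i≢j)))
        (≈-reflexive (cong entry (dec-true (i ≟ i) refl)))

    nonadjacent⇒laplacian≈0 : ∀ {i j} → i ≢ j → adjacent i j ≡ false → laplacian G i j ≈ 0#
    nonadjacent⇒laplacian≈0 i≢j ij = ≈-trans (laplacian-offDiagonal i≢j)
      (≈-trans (-‿cong (≈-reflexive (cong ⟦_⟧ ij))) -0#≈0#)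

    laplacian≈0⇒nonadjacent : CharacteristicZero →
      ∀ {i j} → i ≢ j → laplacian G i j ≈ 0# → adjacent i j ≡ false
    -- An edge would give `1# ≈ 0#`; `char₀ 0` refutes it in the form `1# ⊕ 0#`, to which `1 · 1#`
    -- unfolds.
    laplacian≈0⇒nonadjacent char₀ {i} {j} i≢j L≈0 = ¬-not λ ij → char₀ 0 (begin
      1# ⊕ 0#                 ≈⟨ +-identityʳ 1# ⟩
      1#                      ≡⟨ cong ⟦_⟧ ij ⟨
      ⟦ adjacent i j ⟧        ≈⟨ -‿involutive _ ⟨
      - - ⟦ adjacent i j ⟧    ≈⟨ -‿cong (laplacian-offDiagonal i≢j) ⟨
      - laplacian G i j       ≈⟨ -‿cong L≈0 ⟩
      - 0#                    ≈⟨ -0#≈0# ⟩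
      0#                      ∎)

    -- The reordered Laplacian: cuts, the vectors `e i` and reducibility

    module _ (π : Permutation′ n) where
      private
        P = permutationMatrix π
        L̂ = P ⊗ laplacian G ⊗ P ᵀ

      -- Entries across a cut lie off the diagonal, so they contain no degree.
      π-separated : ∀ {i} k l → i ≤ toℕ k → toℕ l < i → π ⟨$⟩ʳ k ≢ π ⟨$⟩ʳ l
      π-separated k l i≤k l<i eq =
        <⇒≱ l<i (subst (λ x → _ ≤ toℕ x) (⟨$⟩ʳ-injective π eq) i≤k)

      separates⇒zeros : ∀ {i} → Separates G π i →
        ∀ k l → i ≤ toℕ k → toℕ l < i → L̂ k l ≈ 0#
      separates⇒zeros sep k l i≤k l<i = ≈-trans (permutationMatrix-conj π _ k l)
        (nonadjacent⇒laplacian≈0 (π-separated k l i≤k l<i) (sep k l i≤k l<i))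

      -- Symmetry of adjacency clears the upper right block too, of which `Separates` does not speak
      -- directly.
      separates⇒zerosᵀ : ∀ {i} → Separates G π i →
        ∀ k l → toℕ k < i → i ≤ toℕ l → L̂ k l ≈ 0#
      separates⇒zerosᵀ sep k l k<i i≤l = ≈-trans (permutationMatrix-conj π _ k l)
        (nonadjacent⇒laplacian≈0 (π-separated l k i≤l k<i ∘ sym)
          (trans (symmetric _ _) (sep l k i≤l k<i)))

      L̂-rowSum : ∀ k → sum (L̂ k) ≈ 0#
      L̂-rowSum k = begin
        sum (L̂ k)
          ≈⟨ sum-cong-≋ (permutationMatrix-conj π (laplacian G) k) ⟩
        sum (λ l → laplacian G (π ⟨$⟩ʳ k) (π ⟨$⟩ʳ l))
          ≈⟨ sum-permute (laplacian G (π ⟨$⟩ʳ k)) π ⟨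
        sum (laplacian G (π ⟨$⟩ʳ k))
          ≈⟨ laplacian-rowSum (π ⟨$⟩ʳ k) ⟩
        0# ∎

      separates⇒L̂e≋0 : ∀ {i} → Separates G π i → L̂ ⊗ᵥ e i ≋ 0ᵥ
      separates⇒L̂e≋0 {i} sep k with toℕ k <? i
      -- Below the cut each product has a zero factor: the matrix entry left of the cut, the vector
      -- entry right of it.
      ... | no k≮i = sum-zero _ entry
        where
        entry : ∀ j → L̂ k j * e i j ≈ 0#
        entry j with toℕ j <? i
        ... | yes j<i = ≈-trans (*-congʳ (separates⇒zeros sep k j (≮⇒≥ k≮i) j<i)) (zeroˡ _)
        ... | no  j≮i = ≈-trans (*-congˡ (e-≥ (≮⇒≥ j≮i))) (zeroʳ _)
      -- Above the cut the vector only removes entries that vanish anyway, so the whole row sum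
      -- remains.
      ... | yes k<i = ≈-trans (sum-cong-≋ entry) (L̂-rowSum k)
        where
        entry : ∀ j → L̂ k j * e i j ≈ L̂ k j
        entry j with toℕ j <? i
        ... | yes j<i = ≈-trans (*-congˡ (e-< j<i)) (*-identityʳ _)
        ... | no  j≮i = begin
          L̂ k j * e i j   ≈⟨ *-congˡ (e-≥ (≮⇒≥ j≮i)) ⟩
          L̂ k j * 0#      ≈⟨ zeroʳ _ ⟩
          0#              ≈⟨ separates⇒zerosᵀ sep k j k<i (≮⇒≥ j≮i) ⟨
          L̂ k j           ∎

      L̂e≋0⇒separates : CharacteristicZero → ∀ {i} → L̂ ⊗ᵥ e i ≋ 0ᵥ → Separates G π i
      L̂e≋0⇒separates char₀ {i} L̂e≋0 k l i≤k l<i =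
        trans (sym (b-< l<i)) (sum-⟦⟧≈0⇒false char₀ b sum≈0 l)
        where
        adj b : Fin n → Bool
        adj j = adjacent (π ⟨$⟩ʳ k) (π ⟨$⟩ʳ j)
        -- Marks the neighbours among the first `i` nodes. Being Boolean on all of `Fin n`, it fits
        -- `sum-⟦⟧≈0⇒false`.
        b j = adj j ∧ does (toℕ j <? i)

        b-< : ∀ {j} → toℕ j < i → b j ≡ adj j
        b-< {j} j<i =
          trans (cong (adj j ∧_) (dec-true (toℕ j <? i) j<i)) (∧-identityʳ _)

        b-≥ : ∀ {j} → i ≤ toℕ j → b j ≡ false
        b-≥ {j} i≤j =
          trans (cong (adj j ∧_) (dec-false (toℕ j <? i) (≤⇒≯ i≤j))) (∧-zeroʳ _)

        entry : ∀ j → - ⟦ b j ⟧ ≈ L̂ k j * e i j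
        entry j with toℕ j <? i
        ... | yes j<i = begin
          - ⟦ b j ⟧         ≡⟨ cong (λ x → - ⟦ x ⟧) (b-< j<i) ⟩
          - ⟦ adj j ⟧       ≈⟨ laplacian-offDiagonal (π-separated k j i≤k j<i) ⟨
          laplacian G _ _   ≈⟨ permutationMatrix-conj π _ k j ⟨
          L̂ k j             ≈⟨ *-identityʳ _ ⟨
          L̂ k j * 1#        ≈⟨ *-congˡ (e-< j<i) ⟨
          L̂ k j * e i j     ∎
        ... | no j≮i = begin
          - ⟦ b j ⟧         ≡⟨ cong (λ x → - ⟦ x ⟧) (b-≥ (≮⇒≥ j≮i)) ⟩
          - 0#              ≈⟨ -0#≈0# ⟩
          0#                ≈⟨ zeroʳ _ ⟨
          L̂ k j * 0#        ≈⟨ *-congˡ (e-≥ (≮⇒≥ j≮i)) ⟨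
          L̂ k j * e i j     ∎

        sum≈0 : sum (λ j → ⟦ b j ⟧) ≈ 0#
        sum≈0 = -‿injective (begin
          - sum (λ j → ⟦ b j ⟧)     ≈⟨ sum-neg (λ j → ⟦ b j ⟧) ⟨
          sum (λ j → - ⟦ b j ⟧)     ≈⟨ sum-cong-≋ entry ⟩
          (L̂ ⊗ᵥ e i) k              ≈⟨ L̂e≋0 k ⟩
          0#                        ≈⟨ -0#≈0# ⟨
          - 0#                      ∎)

      reducible⇒separates : CharacteristicZero → 1 < n → IsRCM G π → Reducible L̂ →
        ∃ λ i → 1 ≤ i × i ≤ n ∸ 1 × Separates G π i
      reducible⇒separates char₀ 1<n rcm reducible
        with σ , r , 1≤r , r≤n∸1 , zeros ← reducible⇒zeros 1<n reducible
        = conclude (rcm-separates⊎monochromatic G colour edge-colour π rcm)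
        where
        ρ : Permutation′ n
        -- Takes an original node to its new number and then to its position in the block form.
        ρ = flip π ∘ₚ σ

        colour : Fin n → Bool
        colour v = does (toℕ (ρ ⟨$⟩ʳ v) <? r)

        nonadjacent : ∀ u v → r ≤ toℕ (ρ ⟨$⟩ʳ u) → toℕ (ρ ⟨$⟩ʳ v) < r → adjacent u v ≡ false
        nonadjacent u v r≤u v<r =
          laplacian≈0⇒nonadjacent char₀ (λ { refl → <⇒≱ v<r r≤u }) (begin
            laplacian G u v              ≡⟨ cong₂ (laplacian G) (inverseʳ π) (inverseʳ π) ⟨
            laplacian G _ _              ≈⟨ permutationMatrix-conj π _ _ _ ⟨
            L̂ (π ⟨$⟩ˡ u) (π ⟨$⟩ˡ v)      ≈⟨ zeros _ _ r≤u v<r ⟩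
            0#                           ∎)

        edge-colour : ∀ {u v} → adjacent u v ≡ true → colour u ≡ colour v
        edge-colour {u} {v} uv = same (_ <? r) (_ <? r)
          where
          same : (u? : Dec (toℕ (ρ ⟨$⟩ʳ u) < r)) (v? : Dec (toℕ (ρ ⟨$⟩ʳ v) < r)) →
                 does u? ≡ does v?
          same (yes _)   (yes _)   = refl
          same (no  _)   (no  _)   = refl
          same (no  u≮r) (yes v<r) =
            contradiction (trans (sym uv) (nonadjacent u v (≮⇒≥ u≮r) v<r)) λ ()
          -- The zero block excludes edges in one direction only; symmetry of the graph covers this
          -- case.
          same (yes u<r) (no  v≮r) = contradiction
            (trans (sym uv) (trans (symmetric u v) (nonadjacent v u (≮⇒≥ v≮r) u<r))) λ ()

        colour-at : ∀ {i} (i<n : i < n) → colour (ρ ⟨$⟩ˡ fromℕ< i<n) ≡ does (i <? r)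
        colour-at i<n =
          cong (λ x → does (x <? r)) (trans (cong toℕ (inverseʳ ρ)) (toℕ-fromℕ< i<n))

        r<n : r < n
        r<n = i≤n∸1⇒i<n 1≤r r≤n∸1

        0<n : 0 < n
        0<n = ≤-trans (s≤s z≤n) 1<n

        conclude : (∃ λ i → 1 ≤ i × i ≤ n ∸ 1 × Separates G π i) ⊎
                   (∀ v w → colour v ≡ colour w) →
                   ∃ λ i → 1 ≤ i × i ≤ n ∸ 1 × Separates G π i
        conclude (inj₁ separated) = separated
        -- Both colours occur: position `0` lies in the first block because `1 ≤ r`, and position
        -- `r` exists in the second because `r < n`.
        conclude (inj₂ mono)      = contradiction
          (trans (sym (trans (colour-at 0<n) (dec-true (0 <? r) 1≤r)))
            (trans (mono _ _) (trans (colour-at r<n) (dec-false (r <? r) (<-irrefl refl)))))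
          λ ()

theorem4p1 : ∀ {c ℓ} (R : CommutativeRing c ℓ) (let open Matrices R) → CharacteristicZero →
    (n : ℕ) → 1 < n →
    (G : Graph n) (π : Permutation′ n) → IsRCM G π →
    (let P = permutationMatrix π
         L̂ = P ⊗ laplacian G ⊗ P ᵀ) →
    Irreducible L̂ ⇔ (∀ i → 1 ≤ i → i ≤ n ∸ 1 → ¬ (L̂ ⊗ᵥ e i ≋ 0ᵥ))
theorem4p1 R char₀ n 1<n G π rcm = mk⇔
  (λ irreducible i 1≤i i≤n∸1 L̂e≋0 → irreducible
    (zeros⇒reducible 1<n i 1≤i i≤n∸1
      (separates⇒zeros G π (L̂e≋0⇒separates G π char₀ L̂e≋0))))
  (λ L̂e≢0 reducible →
    let i , 1≤i , i≤n∸1 , sep = reducible⇒separates G π char₀ 1<n rcm reducible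
    in L̂e≢0 i 1≤i i≤n∸1 (separates⇒L̂e≋0 G π sep))
  where open MatrixProperties R
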